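{- Let $q$ be a prime power and $L(x)=ax+bx^q+cx^{q^2}\in\mathbb{F}_{q^5}[x]$. Let $u=\frac{a^qc}{b^{q+1}}$. Then $L(x)$ has $q^2$ roots in $\mathbb{F}_{q^5}$ if and only if $b\neq 0$, $(1-u)^{q^2+1}-u^q=0$, and $N(1-u)=N(c/b)$, where $N$ is the norm from $\mathbb{F}_{q^5}$ to $\mathbb{F}_q$.
   Context: $N(x)=x^{1+q+q^2+q^3+q^4}$ for $x\in\mathbb{F}_{q^5}$. Roots are counted in $\mathbb{F}_{q^5}$. -}

module Defs where

open import Level using (Level; _⊔_; suc)
open import Data.Nat as ℕ using (ℕ)
open import Data.Nat.Primality using (Prime)
open import Data.Fin using (Fin)
open import Data.List using (length; filter; allFin)
open import Data.Product using (Σ; ∃₂; _×_)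
open import Relation.Nullary using (¬_)
open import Relation.Binary.PropositionalEquality using (_≡_)
open import Relation.Binary using (Decidable)
open import Algebra.Bundles using (CommutativeRing; Semiring)
import Algebra.Definitions.RawSemiring as RawSemiringDefs

IsPrimePower : ℕ → Set
IsPrimePower q = ∃₂ λ p k → Prime p × q ≡ p ℕ.^ ℕ.suc k

-- A finite field: a commutative ring with decidable equality, 1 ≉ 0,
-- inverses of nonzero elements (inv is total; its value at 0 is irrelevant),
-- and an enumeration Fin size → Carrier which is a bijection up to ≈.
record FiniteField (c ℓ : Level) : Set (suc (c ⊔ ℓ)) where
  field
    cring     : CommutativeRing c ℓ
  open CommutativeRing cring public
  field
    _≟_       : Decidable _≈_
    1≉0       : ¬ (1# ≈ 0#)
    inv       : Carrier → Carrier
    inv-r     : ∀ x → ¬ (x ≈ 0#) → x * inv x ≈ 1#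
    size      : ℕ
    enum      : Fin size → Carrier
    enum-inj  : ∀ i j → enum i ≈ enum j → i ≡ j
    enum-surj : ∀ x → Σ (Fin size) λ i → enum i ≈ x
  open RawSemiringDefs (Semiring.rawSemiring semiring) public using (_^_)

module _ {c ℓ} (F : FiniteField c ℓ) where
  open FiniteField F

  numRoots : (Carrier → Carrier) → ℕ
  numRoots f = length (filter (λ i → f (enum i) ≟ 0#) (allFin size))

  linPoly : ℕ → Carrier → Carrier → Carrier → Carrier → Carrier
  linPoly q a b c' x = a * x + b * (x ^ q) + c' * (x ^ (q ℕ.^ 2))

  norm5 : ℕ → Carrier → Carrier
  norm5 q x = x ^ (1 ℕ.+ q ℕ.+ q ℕ.^ 2 ℕ.+ q ℕ.^ 3 ℕ.+ q ℕ.^ 4)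

  uVal : ℕ → Carrier → Carrier → Carrier → Carrier
  uVal q a b c' = (a ^ q) * c' * inv (b ^ (q ℕ.+ 1))

{-# OPTIONS --safe #-}
module Submission where

-- Let σ be the q-power Frobenius. For c ≠ 0 put L = σ² + Bσ + A with B = b/c, A = a/c, and divide
-- on the right in the skew polynomial ring: σ⁵ = M L + ασ + β. Since σ⁵ = 1 on the field, L has q²
-- roots iff α = 0 and β = 1: a nonzero ασ + (β − 1) has at most q roots, and conversely M ∘ L = 0
-- bounds the image of L by deg M = q³. With w = −u, P = −B and t = 1 + w = 1 − u, one finds
-- α = P σP σ²P σ³P E for E = t σ²t + σw, and, when E = 0, β = N(B) N(t).

open import Defs
open import Level using (Level; _⊔_)
open import Data.Nat as ℕ using (ℕ; zero; suc; s≤s; z≤n; _≤_; _<_)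
import Data.Nat.Properties as ℕ
open import Data.Nat.Primality using (Prime; euclidsLemma; prime⇒nonZero; prime⇒nonTrivial)
open import Data.Nat.Divisibility using (_∣_; ∣⇒≤; m∣m*n; divides)
open import Data.Nat.Combinatorics using (_C_; nCk≡n!/k![n-k]!; k![n∸k]!∣n!; nCn≡1)
open import Data.Nat.DivMod using (m/n*n≡m)
open import Data.Fin as Fin using (Fin; zero; suc; fromℕ; inject₁; punchIn)
import Data.Fin.Properties as Fin
open import Data.Fin.Permutation using (Permutation; permutation; _⟨$⟩ʳ_)
open import Data.List using (List; []; _∷_; length; filter; allFin)
open import Data.List.Properties using (filter-≐; filter-all; length-tabulate)
open import Data.List.Relation.Unary.All as All using (All; []; _∷_)
import Data.List.Relation.Unary.All.Properties as All
open import Data.List.Relation.Unary.AllPairs using ([]; _∷_)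
open import Data.List.Relation.Unary.Unique.Propositional using (Unique)
open import Data.List.Relation.Unary.Unique.Propositional.Properties as Unique using (allFin⁺)
open import Data.List.Relation.Unary.Any using (here; there)
open import Data.List.Membership.Propositional using (_∈_)
open import Data.List.Membership.Propositional.Properties using (∈-filter⁺; ∈-allFin)
open import Data.Product using (∃; _×_; _,_; proj₁; proj₂)
open import Data.Sum using (inj₁; inj₂)
open import Function using (_∘_; id)
open import Function.Bundles using (_⇔_; mk⇔; Equivalence)
open import Relation.Nullary using (¬_; yes; no; contradiction; ¬?)
open import Relation.Nullary.Decidable using (_×-dec_)
open import Relation.Binary using (DecidableEquality)
open import Relation.Unary using (Decidable; Pred)
open import Relation.Binary.PropositionalEquality as ≡ using (_≡_; _≢_)

-- The field is known only through an enumeration, so its arithmetic comes from reindexing sums and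
-- products over all elements. Dimension is replaced by counting: a kernel is bounded by a degree,
-- and it is shown to be large by bounding the image.
--
-- The shape of u comes from eliminating A: since A = a/c and B = b/c, one has σA = u BσB. Every
-- conjugate of A thus turns into conjugates of B times a conjugate of u, and the conjugates of B
-- factor out of α and β. What remains is a polynomial in conjugates of w alone. That it yields a
-- norm when E = 0 rests on the conjugates of E: σ³E = 0 and σ⁴E = 0 express σ⁴w and w through
-- products of conjugates of t, and together with E itself these supply all five factors of N(t).
--
-- Two degenerate cases lie outside this computation. If c = 0 there is no monic L, and both sides
-- of the equivalence fail. If b = 0 the quotient u is meaningless, but then β = 0, so β = 1 is
-- impossible.

-- Prime divisors of binomial coefficients

prime∤! : ∀ {p} → Prime p → ∀ k → k < p → ¬ (p ∣ k ℕ.!)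
prime∤! pr zero    k<p p∣1 = ℕ.<⇒≱ (ℕ.nonTrivial⇒n>1 _ {{prime⇒nonTrivial pr}}) (∣⇒≤ p∣1)
prime∤! pr (suc k) k<p p∣k! with euclidsLemma (suc k) (k ℕ.!) pr p∣k!
... | inj₁ p∣1+k = ℕ.<⇒≱ k<p (∣⇒≤ p∣1+k)
... | inj₂ p∣k!′ = prime∤! pr k (ℕ.<-trans (ℕ.n<1+n k) k<p) p∣k!′

-- In C(p,k) k! (p-k)! = p! the right side is divisible by p, while k and p-k are both below p, so
-- neither factorial on the left is.
prime∣C : ∀ {p} → Prime p → ∀ {k} → 0 < k → k < p → p ∣ p C k
prime∣C {suc p-1} pr {suc k-1} 0<k k<p
  with euclidsLemma (p C k) _ pr (≡.subst (p ∣_) (≡.sym C*!≡!) (m∣m*n (p-1 ℕ.!)))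
  where
  p = suc p-1
  k = suc k-1
  instance _ = ℕ._!*_!≢0 k (p ℕ.∸ k)
  C*!≡! : (p C k) ℕ.* (k ℕ.! ℕ.* (p ℕ.∸ k) ℕ.!) ≡ p ℕ.!
  C*!≡! = ≡.trans (≡.cong (ℕ._* (k ℕ.! ℕ.* (p ℕ.∸ k) ℕ.!)) (nCk≡n!/k![n-k]! (ℕ.<⇒≤ k<p)))
                  (m/n*n≡m (k![n∸k]!∣n! (ℕ.<⇒≤ k<p)))
... | inj₁ p∣C = p∣C
... | inj₂ p∣! with euclidsLemma (suc k-1 ℕ.!) _ pr p∣!
...   | inj₁ p∣k! = contradiction p∣k! (prime∤! pr (suc k-1) k<p)
...   | inj₂ p∣[p-k]! = contradiction p∣[p-k]!
          (prime∤! pr _ (ℕ.∸-monoʳ-< (s≤s z≤n) (ℕ.<⇒≤ k<p)))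

-- Counting by fibres

module _ {a} {A : Set a} {p} {P : Pred A p} (P? : Decidable P) where

  length-filter-¬ : ∀ xs → length xs ≡ length (filter P? xs) ℕ.+ length (filter (¬? ∘ P?) xs)
  length-filter-¬ [] = ≡.refl
  length-filter-¬ (x ∷ xs) with P? x
  ... | yes _ = ≡.cong suc (length-filter-¬ xs)
  ... | no  _ = ≡.trans (≡.cong suc (length-filter-¬ xs)) (≡.sym (ℕ.+-suc _ _))

-- Induction on `ys`: the fibre over the head has at most `K` elements, and the elements outside it
-- map into the tail.
length≤fibres : ∀ {a b} {A : Set a} {B : Set b} → DecidableEquality B → ∀ {K} (f : A → B) →
  (∀ y {zs} → Unique zs → All (λ z → f z ≡ y) zs → length zs ≤ K) →
  ∀ xs ys → Unique xs → All (λ x → f x ∈ ys) xs → length xs ≤ length ys ℕ.* K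
length≤fibres _≟_ f bound []       []       xs! f∈ = z≤n
length≤fibres _≟_ f bound (x ∷ xs) []       xs! (() ∷ _)
length≤fibres _≟_ {K} f bound xs (y ∷ ys) xs! f∈ = begin
  length xs                                            ≡⟨ length-filter-¬ y? xs ⟩
  length (filter y? xs) ℕ.+ length (filter (¬? ∘ y?) xs)
    ≤⟨ ℕ.+-mono-≤ (bound y (Unique.filter⁺ y? xs!) (All.all-filter y? xs))
                  (length≤fibres _≟_ f bound _ ys (Unique.filter⁺ (¬? ∘ y?) xs!) rest) ⟩
  K ℕ.+ length ys ℕ.* K                                ∎
  where
  open ℕ.≤-Reasoning
  y? = λ x → f x ≟ y
  drop-head : ∀ {z} → f z ∈ y ∷ ys → f z ≢ y → f z ∈ ys
  drop-head (here fz≡y) fz≢y = contradiction fz≡y fz≢y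
  drop-head (there fz∈) fz≢y = fz∈
  rest : All (λ x → f x ∈ ys) (filter (¬? ∘ y?) xs)
  rest = All.zipWith (λ (fz∈ , fz≢y) → drop-head fz∈ fz≢y)
                     (All.filter⁺ (¬? ∘ y?) f∈ , All.all-filter (¬? ∘ y?) xs)

primePower>1 : ∀ {q} → IsPrimePower q → 1 < q
primePower>1 (p , k , p-prime , ≡.refl) = ℕ.^-monoʳ-< p 1<p {0} {suc k} (s≤s z≤n)
  where 1<p = ℕ.nonTrivial⇒n>1 p {{prime⇒nonTrivial p-prime}}

-- The arithmetic behind `numRoots-maximal`: `s` is the order of the field, `r` and `x` count roots
-- and non-roots, `y` bounds the number of nonzero values. Non-roots fill at most (n-1)m of the nm
-- points, which leaves m roots.
m≤difference : ∀ {m n s r x y} → suc y ≤ n → s ≡ n ℕ.* m → s ≡ r ℕ.+ x → x ≤ y ℕ.* m → m ≤ r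
m≤difference {m} {n} {s} {r} {x} {y} y<n s≡nm s≡r+x x≤ym = ℕ.+-cancelʳ-≤ (y ℕ.* m) _ _ (begin
  m ℕ.+ y ℕ.* m  ≤⟨ ℕ.*-monoˡ-≤ m y<n ⟩
  n ℕ.* m        ≡⟨ s≡nm ⟨
  s              ≡⟨ s≡r+x ⟩
  r ℕ.+ x        ≤⟨ ℕ.+-monoʳ-≤ r x≤ym ⟩
  r ℕ.+ y ℕ.* m  ∎)
  where open ℕ.≤-Reasoning

-- Finite fields given by an enumeration

module FiniteFieldProperties {c ℓ} (F : FiniteField c ℓ) where
  open FiniteField F hiding (zero)
  open import Algebra.Properties.Ring ring using (x≈y⇒x∙y⁻¹≈ε; +-cancelˡ)
  open import Algebra.Properties.CommutativeSemiring.Exp commutativeSemiring using (^-congˡ; ^-assocʳ)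
  open import Algebra.Properties.Semiring.Mult semiring using (×-congʳ; ×1-homo-*; ×-assoc-*) renaming (_×_ to _·_)
  open import Algebra.Properties.Semiring.Sum semiring using (sum; sum-cong-≋; sum-replicate; sum-replicate-zero; sum-permute; sum-init-last; ∑-distrib-+)
  import Algebra.Properties.CommutativeMonoid.Sum *-commutativeMonoid as Π
  open import Algebra.Properties.CommutativeSemiring.Binomial commutativeSemiring using (theorem; binomialTerm)
  open import Algebra.Solver.Ring.NaturalCoefficients.Default commutativeSemiring using (solve; _:=_; _:+_; _:*_)
  open import Relation.Binary.Reasoning.Setoid setoid

  *-cancelˡ-nonzero : ∀ {x} → ¬ (x ≈ 0#) → ∀ {y z} → x * y ≈ x * z → y ≈ z
  *-cancelˡ-nonzero {x} x≉0 {y} {z} xy≈xz = begin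
    y                ≈⟨ cancel y ⟨
    inv x * (x * y)  ≈⟨ *-congˡ xy≈xz ⟩
    inv x * (x * z)  ≈⟨ cancel z ⟩
    z                ∎
    where
    cancel : ∀ t → inv x * (x * t) ≈ t
    cancel t = begin
      inv x * (x * t)  ≈⟨ solve 3 (λ i x t → i :* (x :* t) := x :* i :* t) refl (inv x) x t ⟩
      x * inv x * t    ≈⟨ *-congʳ (inv-r x x≉0) ⟩
      1# * t           ≈⟨ *-identityˡ t ⟩
      t                ∎

  x*y≈0⇒y≈0 : ∀ {x} → ¬ (x ≈ 0#) → ∀ {y} → x * y ≈ 0# → y ≈ 0#
  x*y≈0⇒y≈0 x≉0 xy≈0 = *-cancelˡ-nonzero x≉0 (trans xy≈0 (sym (zeroʳ _)))

  x*y≉0 : ∀ {x y} → ¬ (x ≈ 0#) → ¬ (y ≈ 0#) → ¬ (x * y ≈ 0#)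
  x*y≉0 x≉0 y≉0 xy≈0 = y≉0 (x*y≈0⇒y≈0 x≉0 xy≈0)

  x^n≈0⇒x≈0 : ∀ {x} n → x ^ n ≈ 0# → x ≈ 0#
  x^n≈0⇒x≈0 zero    1≈0 = contradiction 1≈0 1≉0
  x^n≈0⇒x≈0 {x} (suc n) eq with x ≟ 0#
  ... | yes x≈0 = x≈0
  ... | no  x≉0 = x^n≈0⇒x≈0 n (x*y≈0⇒y≈0 x≉0 eq)

  index : Carrier → Fin size
  index x = proj₁ (enum-surj x)

  enum-index : ∀ x → enum (index x) ≈ x
  enum-index x = proj₂ (enum-surj x)

  index-unique : ∀ {x i} → x ≈ enum i → index x ≡ i
  index-unique x≈ = enum-inj _ _ (trans (enum-index _) x≈)

  -- Substitution in sums and products over the field. It is applied to translation by 1 and to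
  -- multiplication by a nonzero element.
  reindex : (h h⁻¹ : Carrier → Carrier) →
    (∀ {x y} → x ≈ y → h x ≈ h y) → (∀ {x y} → x ≈ y → h⁻¹ x ≈ h⁻¹ y) →
    (∀ x → h (h⁻¹ x) ≈ x) → (∀ x → h⁻¹ (h x) ≈ x) → Permutation size size
  reindex h h⁻¹ h-cong h⁻¹-cong hh⁻¹ h⁻¹h = permutation (index ∘ h ∘ enum) (index ∘ h⁻¹ ∘ enum)
    (λ i → index-unique (trans (h-cong (enum-index _)) (hh⁻¹ _)))
    (λ i → index-unique (trans (h⁻¹-cong (enum-index _)) (h⁻¹h _)))

  -- Translation by 1 permutes the field, so adding 1 to every summand leaves the sum of all
  -- elements unchanged.
  size·1≈0 : size · 1# ≈ 0#
  size·1≈0 = +-cancelˡ (sum enum) _ _ (begin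
    sum enum + size · 1#          ≈⟨ +-congˡ (sum-replicate size) ⟨
    sum enum + sum {size} (λ _ → 1#)     ≈⟨ ∑-distrib-+ enum (λ _ → 1#) ⟨
    sum (λ i → enum i + 1#)       ≈⟨ sum-cong-≋ {size} (λ i → sym (enum-index _)) ⟩
    sum (λ i → enum (π ⟨$⟩ʳ i))    ≈⟨ sum-permute enum π ⟨
    sum enum                      ≈⟨ +-identityʳ _ ⟨
    sum enum + 0#                 ∎)
    where
    π = reindex (_+ 1#) (_+ - 1#) +-congʳ +-congʳ
      (λ x → trans (+-assoc _ _ _) (trans (+-congˡ (-‿inverseˡ 1#)) (+-identityʳ x)))
      (λ x → trans (+-assoc _ _ _) (trans (+-congˡ (-‿inverseʳ 1#)) (+-identityʳ x)))

  n^k·1≈[n·1]^k : ∀ n k → (n ℕ.^ k) · 1# ≈ (n · 1#) ^ k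
  n^k·1≈[n·1]^k n zero    = +-identityʳ 1#
  n^k·1≈[n·1]^k n (suc k) = trans (×1-homo-* n (n ℕ.^ k)) (*-congˡ (n^k·1≈[n·1]^k n k))

  -- The factor `x` in front fills the slot `i`, where `g` is 1. With `i` the index of zero, this
  -- produces the exponent `size` instead of one less.
  product≈^ : ∀ {n} (i : Fin n) (g : Fin n → Carrier) {x} → g i ≈ 1# → (∀ {j} → j ≢ i → g j ≈ x) →
    x * Π.sum g ≈ x ^ n
  product≈^ {suc n} i g {x} gi≈1 gj≈x = *-congˡ (begin
    Π.sum g                            ≈⟨ Π.sum-remove {i = i} g ⟩
    g i * Π.sum (g ∘ punchIn i)        ≈⟨ *-cong gi≈1 (Π.sum-cong-≋ (λ j → gj≈x (Fin.punchInᵢ≢i i j))) ⟩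
    1# * Π.sum {n} (λ _ → x)           ≈⟨ *-identityˡ _ ⟩
    Π.sum {n} (λ _ → x)                ≈⟨ Π.sum-replicate n ⟩
    x ^ n                              ∎)

  product≉0 : ∀ {n} (g : Fin n → Carrier) → (∀ i → ¬ (g i ≈ 0#)) → ¬ (Π.sum g ≈ 0#)
  product≉0 {zero}  g g≉0 = 1≉0
  product≉0 {suc n} g g≉0 = x*y≉0 (g≉0 zero) (product≉0 (g ∘ suc) (g≉0 ∘ suc))

  atNonzero : (Carrier → Carrier) → Carrier → Carrier
  atNonzero g y with y ≟ 0#
  ... | yes _ = 1#
  ... | no  _ = g y

  atNonzero-0 : ∀ g {y} → y ≈ 0# → atNonzero g y ≈ 1#
  atNonzero-0 g {y} y≈0 with y ≟ 0#
  ... | yes _   = refl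
  ... | no  y≉0 = contradiction y≈0 y≉0

  atNonzero-≉0 : ∀ g {y} → ¬ (y ≈ 0#) → atNonzero g y ≈ g y
  atNonzero-≉0 g {y} y≉0 with y ≟ 0#
  ... | yes y≈0 = contradiction y≈0 y≉0
  ... | no  _   = refl

  -- Multiplication by x ≠ 0 permutes the nonzero elements; 0 contributes a factor 1 to the products.
  x^size≈x : ∀ x → x ^ size ≈ x
  x^size≈x x with x ≟ 0#
  ... | yes x≈0 = trans (0^ (index 0#)) (sym x≈0)
    where
    -- An index is passed in only to show that the exponent is positive.
    0^ : ∀ {n} → Fin n → x ^ n ≈ 0#
    0^ {suc n} _ = trans (*-congʳ x≈0) (zeroˡ _)
  ... | no x≉0 = begin
    x ^ size               ≈⟨ product≈^ (index 0#) (g ∘ enum) (atNonzero-0 _ (enum-index 0#))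
                                (λ j≢ → atNonzero-≉0 _ (j≢ ∘ ≡.sym ∘ index-unique ∘ sym)) ⟨
    x * Π.sum (g ∘ enum)   ≈⟨ *-congˡ Πg≈1 ⟩
    x * 1#                 ≈⟨ *-identityʳ x ⟩
    x                      ∎
    where
    g = atNonzero (λ _ → x)
    f = atNonzero id
    f-cong : ∀ {y z} → y ≈ z → f y ≈ f z
    f-cong {y} {z} y≈z with y ≟ 0#
    ... | yes y≈0 = sym (atNonzero-0 id (trans (sym y≈z) y≈0))
    ... | no  y≉0 = trans y≈z (sym (atNonzero-≉0 id (y≉0 ∘ trans y≈z)))
    f≉0 : ∀ y → ¬ (f y ≈ 0#)
    f≉0 y with y ≟ 0#
    ... | yes _   = 1≉0
    ... | no  y≉0 = y≉0
    f[xy] : ∀ y → f (x * y) ≈ f y * g y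
    f[xy] y with y ≟ 0#
    ... | yes y≈0 = trans (atNonzero-0 id (trans (*-congˡ y≈0) (zeroʳ x))) (sym (*-identityʳ 1#))
    ... | no  y≉0 = trans (atNonzero-≉0 id (x*y≉0 x≉0 y≉0)) (*-comm x y)
    π = reindex (x *_) (inv x *_) *-congˡ *-congˡ
      (λ y → trans (sym (*-assoc _ _ _)) (trans (*-congʳ (inv-r x x≉0)) (*-identityˡ y)))
      (λ y → trans (sym (*-assoc _ _ _)) (trans (*-congʳ (trans (*-comm _ _) (inv-r x x≉0))) (*-identityˡ y)))
    Πg≈1 : Π.sum (g ∘ enum) ≈ 1#
    Πg≈1 = *-cancelˡ-nonzero (product≉0 (f ∘ enum) (f≉0 ∘ enum)) (begin
      Π.sum (f ∘ enum) * Π.sum (g ∘ enum)        ≈⟨ Π.∑-distrib-+ (f ∘ enum) (g ∘ enum) ⟨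
      Π.sum (λ i → f (enum i) * g (enum i))      ≈⟨ Π.sum-cong-≋ (λ i → sym (trans (f-cong (enum-index _)) (f[xy] (enum i)))) ⟩
      Π.sum (λ i → f (enum (π ⟨$⟩ʳ i)))           ≈⟨ Π.sum-permute (f ∘ enum) π ⟨
      Π.sum (f ∘ enum)                           ≈⟨ *-identityʳ _ ⟨
      Π.sum (f ∘ enum) * 1#                      ∎)

  -- Characteristic and Frobenius

  -- By `prime∣C` the inner binomial coefficients are multiples of p, hence vanish. The expansion is
  -- indexed by the exponent of `x`, so its first term is y^p and its last x^p.
  frobenius-+ : ∀ {p} → Prime p → p · 1# ≈ 0# → ∀ x y → (x + y) ^ p ≈ x ^ p + y ^ p
  frobenius-+ {zero} pr p≈0 x y = contradiction ≡.refl (ℕ.≢-nonZero⁻¹ 0 {{prime⇒nonZero pr}})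
  frobenius-+ {p@(suc m)} pr p≈0 x y = begin
    (x + y) ^ p                                            ≈⟨ theorem p x y ⟩
    sum term                                               ≈⟨ sum-init-last term ⟩
    (term zero + sum (term ∘ inject₁ ∘ suc)) + term (fromℕ p)
      ≈⟨ +-cong (+-cong first≈ (trans (sum-cong-≋ middle≈) (sum-replicate-zero m))) last≈ ⟩
    (y ^ p + 0#) + x ^ p                                   ≈⟨ +-congʳ (+-identityʳ _) ⟩
    y ^ p + x ^ p                                          ≈⟨ +-comm _ _ ⟩
    x ^ p + y ^ p                                          ∎
    where
    term = binomialTerm x y p
    n·≈0 : ∀ {n} → p ∣ n → ∀ z → n · z ≈ 0#
    n·≈0 {n} (divides k n≡k*p) z = begin
      n · z               ≈⟨ ×-congʳ n (*-identityˡ z) ⟨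
      n · (1# * z)        ≈⟨ ×-assoc-* n 1# z ⟨
      (n · 1#) * z        ≡⟨ ≡.cong (λ n → (n · 1#) * z) n≡k*p ⟩
      ((k ℕ.* p) · 1#) * z ≈⟨ *-congʳ (×1-homo-* k p) ⟩
      (k · 1#) * (p · 1#) * z ≈⟨ *-congʳ (trans (*-congˡ p≈0) (zeroʳ _)) ⟩
      0# * z              ≈⟨ zeroˡ z ⟩
      0#                  ∎
    first≈ : term zero ≈ y ^ p
    first≈ = trans (+-identityʳ _) (*-identityˡ _)
    last≈ : term (fromℕ p) ≈ x ^ p
    last≈ = begin
      term (fromℕ p)                         ≡⟨ ≡.cong (λ k → (p C k) · (x ^ k * y ^ (p ℕ.∸ k))) (Fin.toℕ-fromℕ p) ⟩
      (p C p) · (x ^ p * y ^ (p ℕ.∸ p))      ≡⟨ ≡.cong₂ (λ k l → k · (x ^ p * y ^ l)) (nCn≡1 p) (ℕ.n∸n≡0 p) ⟩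
      1 · (x ^ p * y ^ 0)                    ≈⟨ +-identityʳ _ ⟩
      x ^ p * 1#                             ≈⟨ *-identityʳ _ ⟩
      x ^ p                                  ∎
    middle≈ : ∀ i → term (inject₁ (suc i)) ≈ 0#
    middle≈ i = n·≈0 (prime∣C pr (s≤s z≤n)
      (≡.subst (_< p) (≡.sym (Fin.toℕ-inject₁ (suc i))) (Fin.toℕ<n (suc i)))) _

  frobenius^-+ : ∀ {p} → Prime p → p · 1# ≈ 0# → ∀ k x y → (x + y) ^ (p ℕ.^ k) ≈ x ^ (p ℕ.^ k) + y ^ (p ℕ.^ k)
  frobenius^-+ pr p≈0 zero x y = trans (*-identityʳ _) (sym (+-cong (*-identityʳ x) (*-identityʳ y)))
  frobenius^-+ {p} pr p≈0 (suc k) x y = begin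
    (x + y) ^ (p ℕ.* p ℕ.^ k)                            ≈⟨ ^-assocʳ (x + y) p (p ℕ.^ k) ⟨
    ((x + y) ^ p) ^ (p ℕ.^ k)                            ≈⟨ ^-congˡ (p ℕ.^ k) (frobenius-+ pr p≈0 x y) ⟩
    (x ^ p + y ^ p) ^ (p ℕ.^ k)                          ≈⟨ frobenius^-+ pr p≈0 k (x ^ p) (y ^ p) ⟩
    (x ^ p) ^ (p ℕ.^ k) + (y ^ p) ^ (p ℕ.^ k)            ≈⟨ +-cong (^-assocʳ x p (p ℕ.^ k)) (^-assocʳ y p (p ℕ.^ k)) ⟩
    x ^ (p ℕ.* p ℕ.^ k) + y ^ (p ℕ.* p ℕ.^ k)            ∎

  -- The order of the field is zero in the field and is a power of p; since there are no nilpotents,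
  -- p is zero as well.
  char-root : ∀ p k → size ≡ p ℕ.^ k → p · 1# ≈ 0#
  char-root p k size≡ = x^n≈0⇒x≈0 k (begin
    (p · 1#) ^ k       ≈⟨ n^k·1≈[n·1]^k p k ⟨
    (p ℕ.^ k) · 1#     ≡⟨ ≡.cong (_· 1#) size≡ ⟨
    size · 1#          ≈⟨ size·1≈0 ⟩
    0#                 ∎)

  primePower-^-+ : ∀ {q} → IsPrimePower q → ∀ n → size ≡ q ℕ.^ n → ∀ x y → (x + y) ^ q ≈ x ^ q + y ^ q
  primePower-^-+ (p , k , p-prime , ≡.refl) n size≡ = frobenius^-+ p-prime
    (char-root p (suc k ℕ.* n) (≡.trans size≡ (ℕ.^-*-assoc p (suc k) n))) (suc k)

  -- Polynomial functions and their roots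

  -- Poly n l f: f is a polynomial function of degree at most n whose coefficient at xⁿ is l.
  data Poly : ℕ → Carrier → (Carrier → Carrier) → Set (c ⊔ ℓ) where
    constant : ∀ {l f} → (∀ x → f x ≈ l) → Poly 0 l f
    horner   : ∀ {n l f g} k → Poly n l g → (∀ x → f x ≈ k + x * g x) → Poly (suc n) l f

  Poly-resp : ∀ {n l m f g} → l ≈ m → (∀ x → g x ≈ f x) → Poly n l f → Poly n m g
  Poly-resp l≈m g≈f (constant eq)   = constant (λ x → trans (g≈f x) (trans (eq x) l≈m))
  Poly-resp l≈m g≈f (horner k P eq) = horner k (Poly-resp l≈m (λ _ → refl) P) (λ x → trans (g≈f x) (eq x))

  Poly-+ : ∀ {n l m f g} → Poly n l f → Poly n m g → Poly n (l + m) (λ x → f x + g x)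
  Poly-+ (constant eq)   (constant eq′)    = constant (λ x → +-cong (eq x) (eq′ x))
  Poly-+ (horner {g = f} k P eq) (horner {g = g} k′ P′ eq′) = horner (k + k′) (Poly-+ P P′) (λ x →
    trans (+-cong (eq x) (eq′ x))
      (solve 5 (λ k k′ x u v → (k :+ x :* u) :+ (k′ :+ x :* v) := (k :+ k′) :+ x :* (u :+ v)) refl k k′ x (f x) (g x)))

  Poly-* : ∀ {n l f} a → Poly n l f → Poly n (a * l) (λ x → a * f x)
  Poly-* a (constant eq)   = constant (λ x → *-congˡ (eq x))
  Poly-* a (horner {g = g} k P eq) = horner (a * k) (Poly-* a P) (λ x → trans (*-congˡ (eq x))
    (solve 4 (λ a k x u → a :* (k :+ x :* u) := a :* k :+ x :* (a :* u)) refl a k x (g x)))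

  Poly-^ : ∀ n → Poly n 1# (_^ n)
  Poly-^ zero    = constant (λ _ → refl)
  Poly-^ (suc n) = horner 0# (Poly-^ n) (λ x → sym (+-identityˡ _))

  Poly-suc : ∀ {n l f} → Poly n l f → Poly (suc n) 0# f
  Poly-suc {l = l} (constant eq) = horner l (constant (λ _ → refl))
    (λ x → trans (eq x) (sym (trans (+-congˡ (zeroʳ x)) (+-identityʳ l))))
  Poly-suc (horner k P eq) = horner k (Poly-suc P) eq

  Poly-≤ : ∀ {m n l f} → m ℕ.≤′ n → Poly m l f → ∃ λ l′ → Poly n l′ f
  Poly-≤ ℕ.≤′-refl      P = _ , P
  Poly-≤ (ℕ.≤′-step le) P = _ , Poly-suc (proj₂ (Poly-≤ le P))

  Poly-+-lower : ∀ {m n l l′ f g} → m < n → Poly n l f → Poly m l′ g → Poly n l (λ x → f x + g x)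
  Poly-+-lower (s≤s m≤n) P P′ = Poly-resp (+-identityʳ _) (λ _ → refl)
    (Poly-+ P (Poly-suc (proj₂ (Poly-≤ (ℕ.≤⇒≤′ m≤n) P′))))

  -- Synthetic division f(x) - f(r) = (x - r) g(x), with the subtracted terms moved across so that
  -- it is an identity over semirings. The quotient inherits the leading coefficient.
  Poly-divide : ∀ {n l f} → Poly (suc n) l f → ∀ r →
    ∃ λ g → Poly n l g × (∀ x → f x + r * g x ≈ f r + x * g x)
  Poly-divide {l = l} {f} (horner {g = g} k (constant eq′) eq) r = (λ _ → l) , constant (λ _ → refl) , λ x → begin
    f x + r * l             ≈⟨ +-congʳ (trans (eq x) (+-congˡ (*-congˡ (eq′ x)))) ⟩
    k + x * l + r * l       ≈⟨ solve 4 (λ k l x r → k :+ x :* l :+ r :* l := k :+ r :* l :+ x :* l) refl k l x r ⟩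
    k + r * l + x * l       ≈⟨ +-congʳ (trans (eq r) (+-congˡ (*-congˡ (eq′ r)))) ⟨
    f r + x * l             ∎
  Poly-divide {f = f} (horner {g = g} k P@(horner _ _ _) eq) r with Poly-divide P r
  -- For f = k + x g one has f(x) - f(r) = (x - r) g(x) + r (g(x) - g(r)), and h is the quotient
  -- already found for g.
  ... | h , H , g≈ = (λ x → g x + r * h x) , Poly-+-lower (ℕ.n<1+n _) P (Poly-* r H) , λ x → begin
    f x + r * (g x + r * h x)        ≈⟨ +-cong (eq x) (*-congˡ (g≈ x)) ⟩
    k + x * g x + r * (g r + x * h x)
      ≈⟨ solve 6 (λ k x r gx gr hx → k :+ x :* gx :+ r :* (gr :+ x :* hx) := k :+ r :* gr :+ x :* (gx :+ r :* hx)) refl k x r (g x) (g r) (h x) ⟩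
    k + r * g r + x * (g x + r * h x) ≈⟨ +-congʳ (eq r) ⟨
    f r + x * (g x + r * h x)        ∎

  -- Dividing out the first root lowers the degree by one. Each other root stays a root of the
  -- quotient: the product of the quotient's value there with a difference of two distinct elements
  -- is zero.
  roots≤degree : ∀ {n l f} → Poly n l f → ¬ (l ≈ 0#) → ∀ {is} → Unique is →
    All (λ i → f (enum i) ≈ 0#) is → length is ≤ n
  roots≤degree P               l≉0 []           []           = z≤n
  roots≤degree (constant eq)   l≉0 (_ ∷ _)      (fi≈0 ∷ _)   = contradiction (trans (sym (eq _)) fi≈0) l≉0
  roots≤degree {f = f} P@(horner _ _ _) l≉0 (_∷_ {i} i∉ is!) (fi≈0 ∷ fis≈0) with Poly-divide P (enum i)
  ... | g , G , f≈ = s≤s (roots≤degree G l≉0 is! (All.zipWith (λ (i≢j , fj≈0) → root i≢j fj≈0) (i∉ , fis≈0)))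
    where
    root : ∀ {j} → i ≢ j → f (enum j) ≈ 0# → g (enum j) ≈ 0#
    root {j} i≢j fj≈0 with g (enum j) ≟ 0#
    ... | yes gj≈0 = gj≈0
    ... | no  gj≉0 = contradiction (enum-inj i j (*-cancelˡ-nonzero gj≉0 (begin
      g (enum j) * enum i                    ≈⟨ *-comm _ _ ⟩
      enum i * g (enum j)                    ≈⟨ +-identityˡ _ ⟨
      0# + enum i * g (enum j)               ≈⟨ +-congʳ fj≈0 ⟨
      f (enum j) + enum i * g (enum j)       ≈⟨ f≈ (enum j) ⟩
      f (enum i) + enum j * g (enum j)       ≈⟨ +-congʳ fi≈0 ⟩
      0# + enum j * g (enum j)               ≈⟨ +-identityˡ _ ⟩
      enum j * g (enum j)                    ≈⟨ *-comm _ _ ⟩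
      g (enum j) * enum j                    ∎))) i≢j

  -- Counting roots in the field

  Root : (Carrier → Carrier) → Fin size → Set ℓ
  Root f i = f (enum i) ≈ 0#

  root? : ∀ f → Decidable (Root f)
  root? f i = f (enum i) ≟ 0#

  roots : (Carrier → Carrier) → List (Fin size)
  roots f = filter (root? f) (allFin size)

  roots! : ∀ f → Unique (roots f)
  roots! f = Unique.filter⁺ (root? f) (allFin⁺ size)

  all-roots : ∀ f → All (Root f) (roots f)
  all-roots f = All.all-filter (root? f) (allFin size)

  numRoots-cong : ∀ {f g} → (∀ x → f x ≈ 0# → g x ≈ 0#) → (∀ x → g x ≈ 0# → f x ≈ 0#) →
    numRoots F f ≡ numRoots F g
  numRoots-cong {f} {g} f⇒g g⇒f = ≡.cong length
    (filter-≐ (root? f) (root? g) ((λ {i} → f⇒g (enum i)) , (λ {i} → g⇒f (enum i))) (allFin size))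

  numRoots-0 : ∀ {f} → (∀ x → f x ≈ 0#) → numRoots F f ≡ size
  numRoots-0 {f} f≈0 = ≡.trans
    (≡.cong length (filter-all (root? f) (All.universal (λ i → f≈0 (enum i)) (allFin size))))
    (length-tabulate id)

  Poly-const-+ : ∀ {n l f} → 0 < n → Poly n l f → ∀ k → Poly n l (λ x → f x + k)
  Poly-const-+ 0<n P k = Poly-+-lower 0<n P (constant {k} (λ _ → refl))

  -- The image of f consists of roots of g, at most n of them, and every fibre of f has at most m points.
  numRoots-maximal : ∀ {m n k l f g} → 0 < m → Poly m k f → ¬ (k ≈ 0#) → Poly n l g → ¬ (l ≈ 0#) →
    g 0# ≈ 0# → (∀ {x y} → x ≈ y → g x ≈ g y) → (∀ x → g (f x) ≈ 0#) → size ≡ n ℕ.* m → numRoots F f ≡ m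
  numRoots-maximal {m} {n} {f = f} {g} 0<m P k≉0 Q l≉0 g0≈0 g-cong gf≈0 size≡ =
    ℕ.≤-antisym (roots≤degree P k≉0 (roots! f) (all-roots f)) (m≤difference 1+ys≤n size≡
        (≡.trans (≡.sym (length-tabulate id)) (length-filter-¬ (root? f) (allFin size)))
        (length≤fibres Fin._≟_ φ fibre xs ys xs! φ∈ys))
    where
    φ : Fin size → Fin size
    φ i = index (f (enum i))
    nonroot? = λ i → ¬? (root? f i)
    xs = filter nonroot? (allFin size)
    xs! = Unique.filter⁺ nonroot? (allFin⁺ size)
    image? = λ i → root? g i ×-dec ¬? (enum i ≟ 0#)
    ys = filter image? (allFin size)
    φ∈ys : All (λ i → φ i ∈ ys) xs
    φ∈ys = All.map (λ {i} fi≉0 → ∈-filter⁺ image? (∈-allFin (φ i))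
      (trans (g-cong (enum-index _)) (gf≈0 _) , (λ eq → fi≉0 (trans (sym (enum-index _)) eq))))
      (All.all-filter nonroot? (allFin size))
    -- `ys` lists only the nonzero roots of `g`; putting the root 0 in front gains the one fibre
    -- that must be filled by roots of `f`.
    1+ys≤n : suc (length ys) ≤ n
    1+ys≤n = roots≤degree Q l≉0
      (All.map (λ { (_ , y≉0) ≡.refl → y≉0 (enum-index 0#) }) (All.all-filter image? (allFin size))
        ∷ Unique.filter⁺ image? (allFin⁺ size))
      (trans (g-cong (enum-index 0#)) g0≈0 ∷ All.map proj₁ (All.all-filter image? (allFin size)))
    fibre : ∀ y {zs} → Unique zs → All (λ z → φ z ≡ y) zs → length zs ≤ m
    fibre y zs! φ≡y = roots≤degree (Poly-const-+ 0<m P (- enum y)) k≉0 zs!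
      (All.map (λ { ≡.refl → x≈y⇒x∙y⁻¹≈ε (sym (enum-index _)) }) φ≡y)

  -- A nonzero two-term polynomial of this form has degree q or 1. It serves both for the remainder
  -- of the right division and for `f` itself when c = 0.
  twoTerm-vanish : ∀ {q a b} → 1 < q → ∀ {is} → Unique is → q < length is →
    All (λ i → a * enum i ^ q + b * enum i ≈ 0#) is → (a ≈ 0#) × (b ≈ 0#)
  twoTerm-vanish {q} {a} {b} 1<q is! q<is vanish with a ≟ 0# | b ≟ 0#
  ... | no a≉0 | _ = contradiction (roots≤degree
    (Poly-+-lower 1<q (Poly-* a (Poly-^ q)) (Poly-* b (Poly-resp refl (λ x → sym (*-identityʳ x)) (Poly-^ 1))))
    (a≉0 ∘ trans (sym (*-identityʳ a))) is! vanish) (ℕ.<⇒≱ q<is)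
  ... | yes a≈0 | yes b≈0 = a≈0 , b≈0
  ... | yes a≈0 | no b≉0 = contradiction (roots≤degree
    (Poly-* b (Poly-resp refl (λ x → sym (*-identityʳ x)) (Poly-^ 1)))
    (b≉0 ∘ trans (sym (*-identityʳ b))) is!
    (All.map (λ eq → trans (sym (trans (+-congʳ (trans (*-congʳ a≈0) (zeroˡ _))) (+-identityˡ _))) eq) vanish))
    (ℕ.<⇒≱ (ℕ.<-trans 1<q q<is))

-- The Frobenius and the norm of the quintic extension

module QuinticExtension {c ℓ} (F : FiniteField c ℓ) (q : ℕ) (q-primePower : IsPrimePower q)
  (size≡q⁵ : FiniteField.size F ≡ q ℕ.^ 5) where

  open FiniteField F hiding (zero)
  open FiniteFieldProperties F
  open import Algebra.Properties.Ring ring using (-‿distribˡ-*; -‿distribʳ-*; -‿involutive; x∙y⁻¹≈ε⇒x≈y; +-cancelˡ; +-inverseˡ-unique; -0#≈0#)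
  open import Algebra.Properties.CommutativeSemiring.Exp commutativeSemiring using (^-congˡ; ^-homo-*; ^-assocʳ; ^-distrib-*)
  open import Algebra.Solver.Ring.NaturalCoefficients.Default commutativeSemiring using (solve; _:=_; _:+_; _:*_; con)
  open import Relation.Binary.Reasoning.Setoid setoid

  1<q : 1 < q
  1<q = primePower>1 q-primePower

  ^q-distrib-+ : ∀ x y → (x + y) ^ q ≈ x ^ q + y ^ q
  ^q-distrib-+ = primePower-^-+ q-primePower 5 size≡q⁵

  -- Iteration, in place of the exponent q^n, lets `σ 0 x` and `σ (suc n) x` compute, so that
  -- conjugates match definitionally; `^q^≈σ` links the two forms.
  σ : ℕ → Carrier → Carrier
  σ zero    x = x
  σ (suc n) x = σ n x ^ q

  σ-cong : ∀ n {x y} → x ≈ y → σ n x ≈ σ n y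
  σ-cong zero    x≈y = x≈y
  σ-cong (suc n) x≈y = ^-congˡ q (σ-cong n x≈y)

  σ-+ : ∀ n x y → σ n (x + y) ≈ σ n x + σ n y
  σ-+ zero    x y = refl
  σ-+ (suc n) x y = trans (^-congˡ q (σ-+ n x y)) (^q-distrib-+ _ _)

  σ-* : ∀ n x y → σ n (x * y) ≈ σ n x * σ n y
  σ-* zero    x y = refl
  σ-* (suc n) x y = trans (^-congˡ q (σ-* n x y)) (^-distrib-* _ _ q)

  σ-0 : ∀ n → σ n 0# ≈ 0#
  σ-0 n = +-cancelˡ (σ n 0#) _ _ (begin
    σ n 0# + σ n 0#  ≈⟨ σ-+ n 0# 0# ⟨
    σ n (0# + 0#)    ≈⟨ σ-cong n (+-identityˡ 0#) ⟩
    σ n 0#           ≈⟨ +-identityʳ _ ⟨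
    σ n 0# + 0#      ∎)

  σ-neg : ∀ n x → σ n (- x) ≈ - σ n x
  σ-neg n x = +-inverseˡ-unique _ _
    (trans (sym (σ-+ n (- x) x)) (trans (σ-cong n (-‿inverseˡ x)) (σ-0 n)))

  ^q^≈σ : ∀ n x → x ^ (q ℕ.^ n) ≈ σ n x
  ^q^≈σ zero    x = *-identityʳ x
  ^q^≈σ (suc n) x = begin
    x ^ (q ℕ.* q ℕ.^ n)  ≡⟨ ≡.cong (x ^_) (ℕ.*-comm q (q ℕ.^ n)) ⟩
    x ^ (q ℕ.^ n ℕ.* q)  ≈⟨ ^-assocʳ x (q ℕ.^ n) q ⟨
    (x ^ (q ℕ.^ n)) ^ q  ≈⟨ ^-congˡ q (^q^≈σ n x) ⟩
    σ n x ^ q            ∎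

  σ⁵≈id : ∀ x → σ 5 x ≈ x
  σ⁵≈id x = begin
    σ 5 x           ≈⟨ ^q^≈σ 5 x ⟨
    x ^ (q ℕ.^ 5)   ≡⟨ ≡.cong (x ^_) size≡q⁵ ⟨
    x ^ size        ≈⟨ x^size≈x x ⟩
    x               ∎

  σ-∘ : ∀ m n x → σ m (σ n x) ≈ σ (m ℕ.+ n) x
  σ-∘ zero    n x = refl
  σ-∘ (suc m) n x = ^-congˡ q (σ-∘ m n x)

  σ-1 : ∀ n → σ n 1# ≈ 1#
  σ-1 zero    = refl
  σ-1 (suc n) = trans (^-congˡ q (σ-1 n)) (1^ q)
    where
    1^ : ∀ k → 1# ^ k ≈ 1#
    1^ zero    = refl
    1^ (suc k) = trans (*-identityˡ _) (1^ k)

  Poly-σ : ∀ n → Poly (q ℕ.^ n) 1# (σ n)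
  Poly-σ n = Poly-resp refl (λ x → sym (^q^≈σ n x)) (Poly-^ (q ℕ.^ n))

  q^-mono-< : ∀ {m n} → m < n → q ℕ.^ m < q ℕ.^ n
  q^-mono-< = ℕ.^-monoʳ-< q 1<q

  N : Carrier → Carrier
  N x = x * σ 1 x * σ 2 x * σ 3 x * σ 4 x

  N-cong : ∀ {x y} → x ≈ y → N x ≈ N y
  N-cong x≈y = *-cong (*-cong (*-cong (*-cong x≈y (σ-cong 1 x≈y)) (σ-cong 2 x≈y)) (σ-cong 3 x≈y)) (σ-cong 4 x≈y)

  N-* : ∀ x y → N (x * y) ≈ N x * N y
  N-* x y = trans (*-cong (*-cong (*-cong (*-congˡ (σ-* 1 x y)) (σ-* 2 x y)) (σ-* 3 x y)) (σ-* 4 x y))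
    (solve 10 (λ a b c d e a′ b′ c′ d′ e′ →
      a :* a′ :* (b :* b′) :* (c :* c′) :* (d :* d′) :* (e :* e′)
        := a :* b :* c :* d :* e :* (a′ :* b′ :* c′ :* d′ :* e′))
      refl x (σ 1 x) (σ 2 x) (σ 3 x) (σ 4 x) y (σ 1 y) (σ 2 y) (σ 3 y) (σ 4 y))

  N-1 : N 1# ≈ 1#
  N-1 = trans (*-cong (*-cong (*-cong (*-congˡ (σ-1 1)) (σ-1 2)) (σ-1 3)) (σ-1 4))
    (solve 0 (con 1 :* con 1 :* con 1 :* con 1 :* con 1 := con 1) refl)

  -- The number of conjugates is odd, so one sign survives. It cancels the sign of -N(t) in
  -- `β≈NB*Nt`.
  N-neg : ∀ x → N (- x) ≈ - N x
  N-neg x = begin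
    N (- x)
      ≈⟨ *-cong (*-cong (*-cong (*-congˡ (σ-neg 1 x)) (σ-neg 2 x)) (σ-neg 3 x)) (σ-neg 4 x) ⟩
    - x * - σ 1 x * - σ 2 x * - σ 3 x * - σ 4 x
      ≈⟨ *-congʳ (*-congʳ (*-congʳ (neg*neg x (σ 1 x)))) ⟩
    x * σ 1 x * - σ 2 x * - σ 3 x * - σ 4 x
      ≈⟨ *-congʳ (*-congʳ (-‿distribʳ-* _ _)) ⟨
    - (x * σ 1 x * σ 2 x) * - σ 3 x * - σ 4 x
      ≈⟨ *-congʳ (neg*neg _ _) ⟩
    x * σ 1 x * σ 2 x * σ 3 x * - σ 4 x
      ≈⟨ -‿distribʳ-* _ _ ⟨
    - N x  ∎
    where
    neg*neg : ∀ y z → - y * - z ≈ y * z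
    neg*neg y z = trans (sym (-‿distribˡ-* y (- z)))
      (trans (-‿cong (sym (-‿distribʳ-* y z))) (-‿involutive _))

  norm5≈N : ∀ x → norm5 F q x ≈ N x
  norm5≈N x = trans (^-homo-* x (1 ℕ.+ q ℕ.+ q ℕ.^ 2 ℕ.+ q ℕ.^ 3) _) (*-cong
    (trans (^-homo-* x (1 ℕ.+ q ℕ.+ q ℕ.^ 2) _) (*-cong
      (trans (^-homo-* x (1 ℕ.+ q) _) (*-congˡ (^q^≈σ 2 x)))
      (^q^≈σ 3 x)))
    (^q^≈σ 4 x))

  -- Right division of σ⁵ by the monic operator

  module Monic (A B : Carrier) where

    L : Carrier → Carrier
    L x = σ 2 x + (B * σ 1 x + A * σ 0 x)

    -- With negated coefficients σ² reduces to Pσ + Q modulo `L`, and the division involves no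
    -- subtraction.
    P = - B
    Q = - A

    -- The leading coefficients met while reducing σ⁵ modulo `L`: `m₂` stands at σ⁴, `m₁` at σ³ and
    -- `m₀` at σ².
    m₂ = σ 3 P
    m₁ = σ 3 Q + σ 3 P * σ 2 P
    m₀ = σ 3 P * σ 2 Q + σ 3 Q * σ 1 P + σ 3 P * σ 2 P * σ 1 P

    M : Carrier → Carrier
    M y = σ 3 y + (m₂ * σ 2 y + (m₁ * σ 1 y + m₀ * σ 0 y))

    α = m₁ * σ 1 Q + m₀ * P
    β = m₀ * Q

    Poly-L : Poly (q ℕ.^ 2) 1# L
    Poly-L = Poly-+-lower (q^-mono-< {1} {2} (s≤s (s≤s z≤n))) (Poly-σ 2)
      (Poly-+-lower (q^-mono-< {0} {1} (s≤s z≤n)) (Poly-* B (Poly-σ 1)) (Poly-* A (Poly-σ 0)))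

    Poly-M : Poly (q ℕ.^ 3) 1# M
    Poly-M = Poly-+-lower (q^-mono-< {2} {3} (s≤s (s≤s (s≤s z≤n)))) (Poly-σ 3)
      (Poly-+-lower (q^-mono-< {1} {2} (s≤s (s≤s z≤n))) (Poly-* m₂ (Poly-σ 2))
        (Poly-+-lower (q^-mono-< {0} {1} (s≤s z≤n)) (Poly-* m₁ (Poly-σ 1)) (Poly-* m₀ (Poly-σ 0))))

    M-cong : ∀ {x y} → x ≈ y → M x ≈ M y
    M-cong x≈y = +-cong (σ-cong 3 x≈y) (+-cong (*-congˡ (σ-cong 2 x≈y))
      (+-cong (*-congˡ (σ-cong 1 x≈y)) (*-congˡ x≈y)))

    M0≈0 : M 0# ≈ 0#
    M0≈0 = trans (+-cong (σ-0 3) (+-cong (*-congˡ (σ-0 2)) (+-congʳ (*-congˡ (σ-0 1)))))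
      (solve 3 (λ a b c → con 0 :+ (a :* con 0 :+ (b :* con 0 :+ c :* con 0)) := con 0) refl m₂ m₁ m₀)

    σ²≈ : ∀ x → σ 2 x ≈ L x + (P * σ 1 x + Q * x)
    σ²≈ x = begin
      σ 2 x
        ≈⟨ solve 1 (λ z → z := z :+ con 0) refl (σ 2 x) ⟩
      σ 2 x + 0#
        ≈⟨ +-congˡ (solve 2 (λ u v → con 0 := con 0 :* u :+ con 0 :* v) refl (σ 1 x) x) ⟩
      σ 2 x + (0# * σ 1 x + 0# * x)
        ≈⟨ +-congˡ (+-cong (*-congʳ (-‿inverseʳ B)) (*-congʳ (-‿inverseʳ A))) ⟨
      σ 2 x + ((B + P) * σ 1 x + (A + Q) * x)
        ≈⟨ solve 7 (λ z u v b p a q → z :+ ((b :+ p) :* u :+ (a :+ q) :* v)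
             := z :+ (b :* u :+ a :* v) :+ (p :* u :+ q :* v)) refl (σ 2 x) (σ 1 x) x B P A Q ⟩
      L x + (P * σ 1 x + Q * x)  ∎

    -- The skew commutation rule: moving σⁿ past a coefficient applies σⁿ to that coefficient.
    σ²⁺ⁿ≈ : ∀ n x → σ (n ℕ.+ 2) x ≈ σ n (L x) + (σ n P * σ (n ℕ.+ 1) x + σ n Q * σ n x)
    σ²⁺ⁿ≈ n x = begin
      σ (n ℕ.+ 2) x                                     ≈⟨ σ-∘ n 2 x ⟨
      σ n (σ 2 x)                                       ≈⟨ σ-cong n (σ²≈ x) ⟩
      σ n (L x + (P * σ 1 x + Q * x))                   ≈⟨ σ-+ n _ _ ⟩
      σ n (L x) + σ n (P * σ 1 x + Q * x)               ≈⟨ +-congˡ (σ-+ n _ _) ⟩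
      σ n (L x) + (σ n (P * σ 1 x) + σ n (Q * x))       ≈⟨ +-congˡ (+-cong (σ-* n _ _) (σ-* n _ _)) ⟩
      σ n (L x) + (σ n P * σ n (σ 1 x) + σ n Q * σ n x) ≈⟨ +-congˡ (+-congʳ (*-congˡ (σ-∘ n 1 x))) ⟩
      σ n (L x) + (σ n P * σ (n ℕ.+ 1) x + σ n Q * σ n x) ∎

    -- On field elements σ⁵ is the identity, so the dividend is `x` itself. Powers from σ⁵ down to
    -- σ² are rewritten until only `σ 1 x` and `x` remain beside the conjugates of `L x`.
    right-division : ∀ x → x ≈ M (L x) + (α * σ 1 x + β * x)
    right-division x = begin
      x                                  ≈⟨ σ⁵≈id x ⟨
      σ 5 x                              ≈⟨ σ²⁺ⁿ≈ 3 x ⟩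
      y₃ + (p₃ * σ 4 x + q₃ * σ 3 x)
        ≈⟨ +-congˡ (+-congʳ (*-congˡ (trans (σ²⁺ⁿ≈ 2 x) (+-congˡ (+-congʳ (*-congˡ σ³≈)))))) ⟩
      y₃ + (p₃ * (y₂ + (p₂ * x₃ + q₂ * σ 2 x)) + q₃ * σ 3 x)
        ≈⟨ +-congˡ (+-cong (*-congˡ (+-congˡ (+-congˡ (*-congˡ (σ²≈ x))))) (*-congˡ σ³≈)) ⟩
      y₃ + (p₃ * (y₂ + (p₂ * x₃ + q₂ * (y₀ + (P * σ 1 x + Q * x)))) + q₃ * x₃)
        ≈⟨ solve 14 (λ p₀ q₀ p₁ q₁ p₂ q₂ p₃ q₃ y₀ y₁ y₂ y₃ x₁ x₀ →
             let x₂ = y₀ :+ (p₀ :* x₁ :+ q₀ :* x₀)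
                 x₃ = y₁ :+ (p₁ :* x₂ :+ q₁ :* x₁)
                 m₁ = q₃ :+ p₃ :* p₂
                 m₀ = p₃ :* q₂ :+ q₃ :* p₁ :+ p₃ :* p₂ :* p₁
             in y₃ :+ (p₃ :* (y₂ :+ (p₂ :* x₃ :+ q₂ :* x₂)) :+ q₃ :* x₃)
                := (y₃ :+ (p₃ :* y₂ :+ (m₁ :* y₁ :+ m₀ :* y₀)))
                   :+ ((m₁ :* q₁ :+ m₀ :* p₀) :* x₁ :+ m₀ :* q₀ :* x₀))
             refl P Q (σ 1 P) (σ 1 Q) p₂ q₂ p₃ q₃ y₀ (σ 1 y₀) y₂ y₃ (σ 1 x) x ⟩
      M (L x) + (α * σ 1 x + β * x)      ∎
      where
      p₂ = σ 2 P
      q₂ = σ 2 Q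
      p₃ = σ 3 P
      q₃ = σ 3 Q
      y₀ = L x
      y₂ = σ 2 y₀
      y₃ = σ 3 y₀
      x₃ = σ 1 y₀ + (σ 1 P * (y₀ + (P * σ 1 x + Q * x)) + σ 1 Q * σ 1 x)
      σ³≈ : σ 3 x ≈ x₃
      σ³≈ = trans (σ²⁺ⁿ≈ 1 x) (+-congˡ (+-congʳ (*-congˡ (σ²≈ x))))

    maximal-kernel⇒ : numRoots F L ≡ q ℕ.^ 2 → (α ≈ 0#) × (β ≈ 1#)
    maximal-kernel⇒ #≡ = proj₁ vanish , x∙y⁻¹≈ε⇒x≈y _ _ (proj₂ vanish)
      where
      remainder : ∀ x → L x ≈ 0# → α * σ 1 x + (β - 1#) * x ≈ 0#
      remainder x Lx≈0 = begin
        α * σ 1 x + (β - 1#) * x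
          ≈⟨ solve 5 (λ a s b o x → a :* s :+ (b :+ o) :* x := a :* s :+ b :* x :+ o :* x) refl α (σ 1 x) β (- 1#) x ⟩
        α * σ 1 x + β * x + - 1# * x
          ≈⟨ +-congʳ (+-identityˡ _) ⟨
        0# + (α * σ 1 x + β * x) + - 1# * x
          ≈⟨ +-congʳ (+-congʳ (trans (M-cong Lx≈0) M0≈0)) ⟨
        M (L x) + (α * σ 1 x + β * x) + - 1# * x
          ≈⟨ +-cong (right-division x) (-‿distribˡ-* 1# x) ⟨
        x + - (1# * x)
          ≈⟨ +-congˡ (-‿cong (*-identityˡ x)) ⟩
        x - x
          ≈⟨ -‿inverseʳ x ⟩
        0#  ∎
      q<# : q < numRoots F L
      q<# = ≡.subst₂ _<_ (ℕ.^-identityʳ q) (≡.sym #≡) (q^-mono-< {1} {2} (s≤s (s≤s z≤n)))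
      vanish = twoTerm-vanish 1<q (roots! L) q<# (All.map (remainder _) (all-roots L))

    maximal-kernel⇐ : α ≈ 0# → β ≈ 1# → numRoots F L ≡ q ℕ.^ 2
    maximal-kernel⇐ α≈0 β≈1 = numRoots-maximal {n = q ℕ.^ 3} (ℕ.<-trans (s≤s z≤n) (q^-mono-< {0} {2} (s≤s z≤n)))
      Poly-L 1≉0 Poly-M 1≉0 M0≈0 M-cong ML≈0
      (≡.trans size≡q⁵ (ℕ.^-distribˡ-+-* q 3 2))
      where
      ML≈0 : ∀ x → M (L x) ≈ 0#
      ML≈0 x = +-cancelˡ x _ _ (begin
        x + M (L x)                        ≈⟨ +-comm _ _ ⟩
        M (L x) + x                        ≈⟨ +-congˡ (solve 2 (λ s x → x := con 0 :* s :+ con 1 :* x) refl (σ 1 x) x) ⟩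
        M (L x) + (0# * σ 1 x + 1# * x)    ≈⟨ +-congˡ (+-cong (*-congʳ α≈0) (*-congʳ β≈1)) ⟨
        M (L x) + (α * σ 1 x + β * x)      ≈⟨ right-division x ⟨
        x                                  ≈⟨ +-identityʳ x ⟨
        x + 0#                             ∎)

    -- Each term of `m₀` contains a conjugate of `P`. Since a maximal kernel needs β = 1, this is
    -- what forces b ≠ 0.
    β-zero : B ≈ 0# → β ≈ 0#
    β-zero B≈0 = begin
      (σ 3 P * σ 2 Q + σ 3 Q * σ 1 P + σ 3 P * σ 2 P * σ 1 P) * Q
        ≈⟨ *-congʳ (+-cong (+-cong (*-congʳ (σP≈0 3)) (*-congˡ (σP≈0 1))) (*-congˡ (σP≈0 1))) ⟩
      (0# * σ 2 Q + σ 3 Q * 0# + σ 3 P * σ 2 P * 0#) * Q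
        ≈⟨ solve 4 (λ a b c d → (con 0 :* a :+ b :* con 0 :+ c :* con 0) :* d := con 0) refl (σ 2 Q) (σ 3 Q) (σ 3 P * σ 2 P) Q ⟩
      0#  ∎
      where
      σP≈0 : ∀ n → σ n P ≈ 0#
      σP≈0 n = trans (σ-cong n (trans (-‿cong B≈0) -0#≈0#)) (σ-0 n)

    -- The remainder in terms of w

    -- In the paper's notation w = −u.
    module Normalised (w : Carrier) (σQ≈ : σ 1 Q ≈ w * (P * σ 1 P)) where

      t = 1# + w
      E = t * σ 2 t + σ 1 w

      σQ : ∀ n → σ (n ℕ.+ 1) Q ≈ σ n w * (σ n P * σ (n ℕ.+ 1) P)
      σQ n = begin
        σ (n ℕ.+ 1) Q                            ≈⟨ σ-∘ n 1 Q ⟨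
        σ n (σ 1 Q)                              ≈⟨ σ-cong n σQ≈ ⟩
        σ n (w * (P * σ 1 P))                    ≈⟨ σ-* n _ _ ⟩
        σ n w * σ n (P * σ 1 P)                  ≈⟨ *-congˡ (σ-* n _ _) ⟩
        σ n w * (σ n P * σ n (σ 1 P))            ≈⟨ *-congˡ (*-congˡ (σ-∘ n 1 P)) ⟩
        σ n w * (σ n P * σ (n ℕ.+ 1) P)          ∎

      σt : ∀ n → σ n t ≈ 1# + σ n w
      σt n = trans (σ-+ n 1# w) (+-congʳ (σ-1 n))

      E≈ : E ≈ (1# + w) * (1# + σ 2 w) + σ 1 w
      E≈ = +-congʳ (*-congˡ (σt 2))

      -- Once the conjugates of `Q` are replaced, the same three conjugates of `P` appear exactly
      -- once in each term and factor out.
      m₀≈ : m₀ ≈ σ 1 P * σ 2 P * σ 3 P * (1# + σ 1 w + σ 2 w)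
      m₀≈ = trans (+-congʳ (+-cong (*-congˡ (σQ 1)) (*-congʳ (σQ 2))))
        (solve 5 (λ p₁ p₂ p₃ w₁ w₂ → p₃ :* (w₁ :* (p₁ :* p₂)) :+ w₂ :* (p₂ :* p₃) :* p₁ :+ p₃ :* p₂ :* p₁
          := p₁ :* p₂ :* p₃ :* (con 1 :+ w₁ :+ w₂)) refl (σ 1 P) (σ 2 P) (σ 3 P) (σ 1 w) (σ 2 w))

      α≈ : α ≈ P * σ 1 P * σ 2 P * σ 3 P * E
      α≈ = begin
        (σ 3 Q + σ 3 P * σ 2 P) * σ 1 Q + m₀ * P
          ≈⟨ +-cong (*-cong (+-congʳ (σQ 2)) σQ≈) (*-congʳ m₀≈) ⟩
        (σ 2 w * (σ 2 P * σ 3 P) + σ 3 P * σ 2 P) * (w * (P * σ 1 P))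
          + σ 1 P * σ 2 P * σ 3 P * (1# + σ 1 w + σ 2 w) * P
          ≈⟨ solve 7 (λ p₀ p₁ p₂ p₃ w₀ w₁ w₂ →
               (w₂ :* (p₂ :* p₃) :+ p₃ :* p₂) :* (w₀ :* (p₀ :* p₁)) :+ p₁ :* p₂ :* p₃ :* (con 1 :+ w₁ :+ w₂) :* p₀
               := p₀ :* p₁ :* p₂ :* p₃ :* ((con 1 :+ w₀) :* (con 1 :+ w₂) :+ w₁))
               refl P (σ 1 P) (σ 2 P) (σ 3 P) w (σ 1 w) (σ 2 w) ⟩
        P * σ 1 P * σ 2 P * σ 3 P * ((1# + w) * (1# + σ 2 w) + σ 1 w)
          ≈⟨ *-congˡ E≈ ⟨
        P * σ 1 P * σ 2 P * σ 3 P * E  ∎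

      β≈ : β ≈ N P * (σ 4 w * (1# + σ 1 w + σ 2 w))
      β≈ = begin
        m₀ * Q
          -- `σQ` reaches only proper conjugates of `Q`, so `Q` is read as σ⁵Q. This also brings in
          -- σ⁴P and P, the two factors missing from N(P).
          ≈⟨ *-cong m₀≈ (trans (sym (σ⁵≈id Q)) (trans (σQ 4) (*-congˡ (*-congˡ (σ⁵≈id P))))) ⟩
        σ 1 P * σ 2 P * σ 3 P * (1# + σ 1 w + σ 2 w) * (σ 4 w * (σ 4 P * P))
          ≈⟨ solve 7 (λ p₀ p₁ p₂ p₃ p₄ g w₄ → p₁ :* p₂ :* p₃ :* g :* (w₄ :* (p₄ :* p₀))
               := p₀ :* p₁ :* p₂ :* p₃ :* p₄ :* (w₄ :* g)) refl P (σ 1 P) (σ 2 P) (σ 3 P) (σ 4 P) _ (σ 4 w) ⟩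
        N P * (σ 4 w * (1# + σ 1 w + σ 2 w))  ∎

      -- Write tᵢ, wᵢ for conjugates. E = 0 gives G = -w t₂, and its conjugates give w₄ = -t₃t and w
      -- = -t₄t₁. Substituting, w₄G = t₃ t w t₂ = -N(t).
      β≈NB*Nt : E ≈ 0# → β ≈ N B * N t
      β≈NB*Nt E≈0 = begin
        β                            ≈⟨ β≈ ⟩
        N P * (σ 4 w * G)            ≈⟨ *-congˡ (+-inverseˡ-unique _ _ w₄G+Nt≈0) ⟩
        N (- B) * - N t              ≈⟨ *-congʳ (N-neg B) ⟩
        - N B * - N t                ≈⟨ -‿distribˡ-* _ _ ⟨
        - (N B * - N t)              ≈⟨ -‿cong (-‿distribʳ-* _ _) ⟨
        - - (N B * N t)              ≈⟨ -‿involutive _ ⟩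
        N B * N t                    ∎
        where
        G = 1# + σ 1 w + σ 2 w
        G+wt₂≈0 : G + w * σ 2 t ≈ 0#
        G+wt₂≈0 = begin
          G + w * σ 2 t               ≈⟨ +-congˡ (*-congˡ (σt 2)) ⟩
          G + w * (1# + σ 2 w)
            ≈⟨ solve 3 (λ w₀ w₁ w₂ → con 1 :+ w₁ :+ w₂ :+ w₀ :* (con 1 :+ w₂)
                 := (con 1 :+ w₀) :* (con 1 :+ w₂) :+ w₁) refl w (σ 1 w) (σ 2 w) ⟩
          (1# + w) * (1# + σ 2 w) + σ 1 w  ≈⟨ E≈ ⟨
          E                           ≈⟨ E≈0 ⟩
          0#                          ∎
        σE : ∀ n → σ n t * σ (n ℕ.+ 2) t + σ (n ℕ.+ 1) w ≈ 0#
        σE n = begin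
          σ n t * σ (n ℕ.+ 2) t + σ (n ℕ.+ 1) w   ≈⟨ +-cong (*-congˡ (σ-∘ n 2 t)) (σ-∘ n 1 w) ⟨
          σ n t * σ n (σ 2 t) + σ n (σ 1 w)       ≈⟨ +-congʳ (σ-* n _ _) ⟨
          σ n (t * σ 2 t) + σ n (σ 1 w)           ≈⟨ σ-+ n _ _ ⟨
          σ n E                                   ≈⟨ σ-cong n E≈0 ⟩
          σ n 0#                                  ≈⟨ σ-0 n ⟩
          0#                                      ∎
        t₃t+w₄≈0 : σ 3 t * t + σ 4 w ≈ 0#
        t₃t+w₄≈0 = trans (+-congʳ (*-congˡ (sym (σ⁵≈id t)))) (σE 3)
        t₄t₁+w≈0 : σ 4 t * σ 1 t + w ≈ 0#
        t₄t₁+w≈0 = trans (sym (+-cong (*-congˡ (^-congˡ q (σ⁵≈id t))) (σ⁵≈id w))) (σE 4)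
        w₄G+Nt≈0 : σ 4 w * G + N t ≈ 0#
        w₄G+Nt≈0 = begin
          σ 4 w * G + N t
            ≈⟨ +-identityʳ _ ⟨
          σ 4 w * G + N t + 0#
            -- This multiple of E is added because the sum then regroups into multiples of σ³E and
            -- σ⁴E.
            ≈⟨ +-congˡ (trans (*-congˡ G+wt₂≈0) (zeroʳ _)) ⟨
          σ 4 w * G + N t + σ 3 t * t * (G + w * σ 2 t)
            ≈⟨ solve 8 (λ w₄ G t₀ t₁ t₂ t₃ t₄ w₀ →
                 w₄ :* G :+ t₀ :* t₁ :* t₂ :* t₃ :* t₄ :+ t₃ :* t₀ :* (G :+ w₀ :* t₂)
                 := (t₃ :* t₀ :+ w₄) :* G :+ t₃ :* t₀ :* t₂ :* (t₄ :* t₁ :+ w₀))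
                 refl (σ 4 w) G t (σ 1 t) (σ 2 t) (σ 3 t) (σ 4 t) w ⟩
          (σ 3 t * t + σ 4 w) * G + σ 3 t * t * σ 2 t * (σ 4 t * σ 1 t + w)
            ≈⟨ +-cong (*-congʳ t₃t+w₄≈0) (*-congˡ t₄t₁+w≈0) ⟩
          0# * G + σ 3 t * t * σ 2 t * 0#
            ≈⟨ solve 2 (λ a b → con 0 :* a :+ b :* con 0 := con 0) refl G _ ⟩
          0#  ∎

  -- Back to the trinomial

  module Trinomial (a b c′ : Carrier) where

    u = uVal F q a b c′
    f = linPoly F q a b c′

    f≈ : ∀ x → f x ≈ a * x + b * σ 1 x + c′ * σ 2 x
    f≈ x = +-congˡ (*-congˡ (^q^≈σ 2 x))

    E-form : (1# - u) ^ (q ℕ.^ 2 ℕ.+ 1) - u ^ q ≈ (1# - u) * σ 2 (1# - u) + σ 1 (- u)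
    E-form = +-cong
      (trans (^-homo-* (1# - u) (q ℕ.^ 2) 1) (trans (*-cong (^q^≈σ 2 _) (*-identityʳ _)) (*-comm _ _)))
      (sym (σ-neg 1 u))

    -- When c = 0 also u = 0, whatever value `inv` takes, and the form evaluates to 1.
    E-form≉0 : c′ ≈ 0# → ¬ ((1# - u) * σ 2 (1# - u) + σ 1 (- u) ≈ 0#)
    E-form≉0 c≈0 E≈0 = 1≉0 (begin
      1#                                          ≈⟨ solve 0 (con 1 := con 1 :* con 1 :+ con 0) refl ⟩
      1# * 1# + 0#                                ≈⟨ +-cong (*-cong 1-u≈1 (trans (σ-cong 2 1-u≈1) (σ-1 2))) (trans (σ-cong 1 -u≈0) (σ-0 1)) ⟨
      (1# - u) * σ 2 (1# - u) + σ 1 (- u)         ≈⟨ E≈0 ⟩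
      0#                                          ∎)
      where
      -u≈0 : - u ≈ 0#
      -u≈0 = trans (-‿cong (trans (*-congʳ (trans (*-congˡ c≈0) (zeroʳ _))) (zeroˡ _))) -0#≈0#
      1-u≈1 : 1# - u ≈ 1#
      1-u≈1 = trans (+-congˡ -u≈0) (+-identityʳ 1#)

    -- Having q² > q roots would force both remaining coefficients to vanish; then every element is
    -- a root, and there are q⁵ of them.
    c≈0⇒#≢q² : c′ ≈ 0# → ¬ (numRoots F f ≡ q ℕ.^ 2)
    c≈0⇒#≢q² c≈0 #≡ = ℕ.<⇒≢ (q^-mono-< {2} {5} (s≤s (s≤s (s≤s z≤n))))
      (≡.trans (≡.sym #≡) (≡.trans (numRoots-0 f≈0) size≡q⁵))
      where
      f≈binomial : ∀ x → f x ≈ b * σ 1 x + a * x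
      f≈binomial x = begin
        f x                                ≈⟨ f≈ x ⟩
        a * x + b * σ 1 x + c′ * σ 2 x     ≈⟨ +-congˡ (trans (*-congʳ c≈0) (zeroˡ _)) ⟩
        a * x + b * σ 1 x + 0#             ≈⟨ trans (+-identityʳ _) (+-comm _ _) ⟩
        b * σ 1 x + a * x                  ∎
      q<# : q < numRoots F f
      q<# = ≡.subst₂ _<_ (ℕ.^-identityʳ q) (≡.sym #≡) (q^-mono-< {1} {2} (s≤s (s≤s z≤n)))
      vanish = twoTerm-vanish 1<q (roots! f) q<# (All.map (trans (sym (f≈binomial _))) (all-roots f))
      f≈0 : ∀ x → f x ≈ 0#
      f≈0 x = trans (f≈binomial x) (trans (+-cong (*-congʳ (proj₁ vanish)) (*-congʳ (proj₂ vanish)))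
        (solve 2 (λ s x → con 0 :* s :+ con 0 :* x := con 0) refl (σ 1 x) x))

    module _ (c≉0 : ¬ (c′ ≈ 0#)) where

      open Monic (a * inv c′) (b * inv c′)

      f≈c*L : ∀ x → f x ≈ c′ * L x
      f≈c*L x = begin
        f x                                          ≈⟨ f≈ x ⟩
        a * x + b * σ 1 x + c′ * σ 2 x
          ≈⟨ solve 6 (λ a x b s c z → a :* x :+ b :* s :+ c :* z
               := c :* z :+ (con 1 :* (b :* s) :+ con 1 :* (a :* x))) refl a x b (σ 1 x) c′ (σ 2 x) ⟩
        c′ * σ 2 x + (1# * (b * σ 1 x) + 1# * (a * x))
          ≈⟨ +-congˡ (+-cong (*-congʳ (inv-r c′ c≉0)) (*-congʳ (inv-r c′ c≉0))) ⟨
        c′ * σ 2 x + (c′ * inv c′ * (b * σ 1 x) + c′ * inv c′ * (a * x))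
          ≈⟨ solve 7 (λ a x b s c z i → c :* z :+ (c :* i :* (b :* s) :+ c :* i :* (a :* x))
               := c :* (z :+ (b :* i :* s :+ a :* i :* x))) refl a x b (σ 1 x) c′ (σ 2 x) (inv c′) ⟩
        c′ * L x                                     ∎

      #f≡#L : numRoots F f ≡ numRoots F L
      #f≡#L = numRoots-cong
        (λ x fx≈0 → x*y≈0⇒y≈0 c≉0 (trans (sym (f≈c*L x)) fx≈0))
        (λ x Lx≈0 → trans (f≈c*L x) (trans (*-congˡ Lx≈0) (zeroʳ c′)))

      B≈0⇔b≈0 : b * inv c′ ≈ 0# ⇔ b ≈ 0#
      B≈0⇔b≈0 = mk⇔
        (x*y≈0⇒y≈0 {inv c′} (λ i≈0 → 1≉0 (trans (sym (inv-r c′ c≉0)) (trans (*-congˡ i≈0) (zeroʳ c′)))) ∘ trans (*-comm _ _))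
        (λ b≈0 → trans (*-congʳ b≈0) (zeroˡ _))

      module _ (b≉0 : ¬ (b ≈ 0#)) where

        -- This is σA = u BσB, with signs absorbed into `P` and `Q`.
        σQ≈ : σ 1 Q ≈ - u * (P * σ 1 P)
        σQ≈ = begin
          σ 1 (- (a * i))                   ≈⟨ trans (σ-neg 1 _) (-‿cong (σ-* 1 a i)) ⟩
          - (σ 1 a * σ 1 i)
            ≈⟨ -‿cong (solve 2 (λ x y → x :* y := x :* y :* con 1 :* con 1) refl (σ 1 a) (σ 1 i)) ⟩
          -- The two units become c/c and b^(q+1)/b^(q+1), which supply the numerator c and the
          -- denominator of u.
          - (σ 1 a * σ 1 i * 1# * 1#)
            ≈⟨ -‿cong (*-cong (*-congˡ (inv-r c′ c≉0)) b^q+1*inv≈1) ⟨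
          - (σ 1 a * σ 1 i * (c′ * i) * (σ 1 b * b * j))
            ≈⟨ -‿cong (solve 7 (λ sa si c i sb b j → sa :* si :* (c :* i) :* (sb :* b :* j)
                 := sa :* c :* j :* (b :* i :* (sb :* si))) refl (σ 1 a) (σ 1 i) c′ i (σ 1 b) b j) ⟩
          - (u * (b * i * (σ 1 b * σ 1 i)))   ≈⟨ -‿cong (*-congˡ (*-congˡ (σ-* 1 b i))) ⟨
          - (u * (B * σ 1 B))               ≈⟨ -‿distribˡ-* _ _ ⟩
          - u * (B * σ 1 B)                 ≈⟨ *-congˡ (-‿involutive _) ⟨
          - u * - - (B * σ 1 B)             ≈⟨ *-congˡ (trans (-‿cong (-‿distribʳ-* _ _)) (-‿distribˡ-* _ _)) ⟩
          - u * (P * - σ 1 B)               ≈⟨ *-congˡ (*-congˡ (σ-neg 1 B)) ⟨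
          - u * (P * σ 1 P)                 ∎
          where
          i = inv c′
          j = inv (b ^ (q ℕ.+ 1))
          B = b * i
          b^q+1*inv≈1 : σ 1 b * b * j ≈ 1#
          b^q+1*inv≈1 = trans
            (*-congʳ (sym (trans (^-homo-* b q 1) (*-congˡ (*-identityʳ b)))))
            (inv-r _ (b≉0 ∘ x^n≈0⇒x≈0 (q ℕ.+ 1)))

        open Normalised (- u) σQ≈

        -- B and c/b are mutually inverse, so N(B)N(t) = 1 says exactly N(t) = N(c/b).
        NB*N[c/b]≈1 : N (b * inv c′) * N (c′ * inv b) ≈ 1#
        NB*N[c/b]≈1 = begin
          N (b * inv c′) * N (c′ * inv b)    ≈⟨ N-* _ _ ⟨
          N (b * inv c′ * (c′ * inv b))
            ≈⟨ N-cong (solve 4 (λ b i c j → b :* i :* (c :* j) := b :* j :* (c :* i)) refl b (inv c′) c′ (inv b)) ⟩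
          N (b * inv b * (c′ * inv c′))      ≈⟨ N-cong (*-cong (inv-r b b≉0) (inv-r c′ c≉0)) ⟩
          N (1# * 1#)                        ≈⟨ N-cong (*-identityˡ 1#) ⟩
          N 1#                               ≈⟨ N-1 ⟩
          1#                                 ∎

        P≉0 : ¬ (P ≈ 0#)
        P≉0 P≈0 = b≉0 (Equivalence.to B≈0⇔b≈0 (trans (sym (-‿involutive _)) (trans (-‿cong P≈0) -0#≈0#)))

        NB≉0 : ¬ (N (b * inv c′) ≈ 0#)
        NB≉0 NB≈0 = 1≉0 (trans (sym NB*N[c/b]≈1) (trans (*-congʳ NB≈0) (zeroˡ _)))

        α≈0⇒E≈0 : α ≈ 0# → E ≈ 0#
        α≈0⇒E≈0 α≈0 = x*y≈0⇒y≈0 (x*y≉0 (x*y≉0 (x*y≉0 P≉0 (σP≉0 1)) (σP≉0 2)) (σP≉0 3)) (trans (sym α≈) α≈0)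
          where
          σP≉0 : ∀ n → ¬ (σ n P ≈ 0#)
          σP≉0 zero    = P≉0
          σP≉0 (suc n) = σP≉0 n ∘ x^n≈0⇒x≈0 q

        -- The pairs cannot be matched entry by entry: the formula for β holds under E = 0, so the
        -- first entry is settled before the second.
        condition⇔ : ((α ≈ 0#) × (β ≈ 1#)) ⇔ ((E ≈ 0#) × (N t ≈ N (c′ * inv b)))
        condition⇔ = mk⇔
          (λ (α≈0 , β≈1) → α≈0⇒E≈0 α≈0 , *-cancelˡ-nonzero NB≉0
            (trans (sym (β≈NB*Nt (α≈0⇒E≈0 α≈0))) (trans β≈1 (sym NB*N[c/b]≈1))))
          (λ (E≈0 , Nt≈) → trans α≈ (trans (*-congˡ E≈0) (zeroʳ _)) ,
            trans (β≈NB*Nt E≈0) (trans (*-congˡ Nt≈) NB*N[c/b]≈1))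

    Condition = ¬ (b ≈ 0#) × ((1# - u) ^ (q ℕ.^ 2 ℕ.+ 1) - u ^ q ≈ 0#) × (norm5 F q (1# - u) ≈ norm5 F q (c′ * inv b))

    q²-roots⇒ : numRoots F f ≡ q ℕ.^ 2 → Condition
    q²-roots⇒ #≡ with c′ ≟ 0#
    ... | yes c≈0 = contradiction #≡ (c≈0⇒#≢q² c≈0)
    ... | no  c≉0 = b≉0 , trans E-form (proj₁ E∧N) , trans (norm5≈N _) (trans (proj₂ E∧N) (sym (norm5≈N _)))
      where
      open Monic (a * inv c′) (b * inv c′)
      α∧β = maximal-kernel⇒ (≡.trans (≡.sym (#f≡#L c≉0)) #≡)
      -- This must precede the use of `condition⇔`, whose normalisation divides by b^(q+1).
      b≉0 : ¬ (b ≈ 0#)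
      b≉0 b≈0 = 1≉0 (trans (sym (proj₂ α∧β)) (β-zero (Equivalence.from (B≈0⇔b≈0 c≉0) b≈0)))
      E∧N = Equivalence.to (condition⇔ c≉0 b≉0) α∧β

    q²-roots⇐ : Condition → numRoots F f ≡ q ℕ.^ 2
    q²-roots⇐ (b≉0 , E≈0 , N≈) with c′ ≟ 0#
    ... | yes c≈0 = contradiction (trans (sym E-form) E≈0) (E-form≉0 c≈0)
    ... | no  c≉0 = ≡.trans (#f≡#L c≉0) (maximal-kernel⇐ (proj₁ α∧β) (proj₂ α∧β))
      where
      open Monic (a * inv c′) (b * inv c′)
      α∧β = Equivalence.from (condition⇔ c≉0 b≉0)
        (trans (sym E-form) E≈0 , trans (sym (norm5≈N _)) (trans N≈ (norm5≈N _)))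

theorem2 : ∀ {c ℓ : Level} (q : ℕ) → IsPrimePower q →
    (F : FiniteField c ℓ) → FiniteField.size F ≡ q ℕ.^ 5 →
    (a b c' : FiniteField.Carrier F) →
    let open FiniteField F
        u = uVal F q a b c'
    in (numRoots F (linPoly F q a b c') ≡ q ℕ.^ 2)
       ⇔ ((¬ (b ≈ 0#))
          × (((1# - u) ^ (q ℕ.^ 2 ℕ.+ 1) - u ^ q) ≈ 0#)
          × (norm5 F q (1# - u) ≈ norm5 F q (c' * inv b)))
theorem2 q q-primePower F size≡q⁵ a b c' = mk⇔ q²-roots⇒ q²-roots⇐
  where
  open QuinticExtension F q q-primePower size≡q⁵
  open Trinomial a b c'
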